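{- If $\mathsf{k}$ is an infinite field with $\mathrm{char}(\mathsf{k})=2$, then $A_{\mathsf{k}}(n,d)\le2^d-1$.
   Context: For a field $\mathsf{k}$, $\mathcal{S}_d^n(\mathsf{k})=\mathsf{k}[x_1,\ldots,x_n]_d$ is the space of homogeneous degree-$d$ polynomials. For a linear form $\ell=\sum_{i=1}^na_ix_i\in\mathcal{S}_1^n(\mathsf{k})$, let $\ell^{[d]}:=\sum_{\alpha\in\mathbb{N}^n,\,|\alpha|=d}a_1^{\alpha_1}\cdots a_n^{\alpha_n}x^\alpha\in\mathcal{S}_d^n(\mathsf{k})$. For $f\in\mathcal{S}_d^n(\mathsf{k})$, $\mathbf{R}^\nu(f)$ is the minimum $r$ such that $f=\sum_{i=1}^r\ell_i^{[d]}$ for some linear forms $\ell_1,\ldots,\ell_r\in\mathcal{S}_1^n(\mathsf{k})$. With $\mathrm{supp}(\sum_\alpha c_\alpha x^\alpha)=\{\alpha:c_\alpha\ne0\}$ and $e_{n,d}=\sum_{1\le i_1<\cdots<i_d\le n}x_{i_1}\cdots x_{i_d}$, define $A_{\mathsf{k}}(n,d):=\min\{\mathbf{R}^\nu(g):g\in\mathcal{S}_d^n(\mathsf{k}),\ \mathrm{supp}(g)=\mathrm{supp}(e_{n,d})\}$. -}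

module Defs where

open import Algebra.Apartness.Bundles using (HeytingField; HeytingCommutativeRing)
open import Algebra.Bundles using (CommutativeRing; Semiring)
import Algebra.Definitions.RawMonoid as RawMonoidDefs
import Algebra.Definitions.RawSemiring as RawSemiringDefs
open import Data.Bool.Base using (if_then_else_)
open import Data.Fin.Base using (Fin; zero; suc)
open import Data.List.Base as List using (List; []; _∷_; _++_)
open import Data.List.Relation.Unary.All using (All)
open import Data.Nat.Base as ℕ using (ℕ; zero; suc; _≤_)
open import Data.Nat.Divisibility using (_∣_)
import Data.Nat.Properties as ℕ
open import Data.Product.Base using (Σ; ∃; ∃-syntax; _×_; _,_; proj₁)
open import Data.Vec.Base as Vec using (Vec; []; _∷_; lookup)
open import Data.Vec.Properties using (≡-dec)
open import Function.Bundles using (_⇔_)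
open import Level using (Level; _⊔_)
open import Relation.Binary.PropositionalEquality using (_≡_; refl; cong)
open import Relation.Nullary.Decidable using (does)
open import Relation.Nullary.Negation.Core using (¬_)
open import Relation.Unary using (Pred; _≐_)

------------------------------------------------------------------------
-- Minima of sets of natural numbers

-- A relation rather than a function: the minimum of an arbitrary inhabited
-- set of naturals cannot be computed.

IsMinimum : ∀ {p} → Pred ℕ p → Pred ℕ p
IsMinimum P m = P m × (∀ k → P k → m ≤ k)

------------------------------------------------------------------------
-- Exponents α ∈ ℕⁿ with |α| = d

Exponent : ℕ → ℕ → Set
Exponent n d = Σ (Vec ℕ n) λ α → Vec.sum α ≡ d

infixr 5 _∷ᵉ_

_∷ᵉ_ : ∀ {n d} (a : ℕ) → Exponent n d → Exponent (suc n) (a ℕ.+ d)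
a ∷ᵉ (α , |α|≡d) = a ∷ α , cong (a ℕ.+_) |α|≡d

zeroᵉ : ∀ n → Exponent n 0
zeroᵉ zero    = [] , refl
zeroᵉ (suc n) = 0 ∷ᵉ zeroᵉ n

-- The exponent of the variable xᵢ.

unitᵉ : ∀ {n} → Fin n → Exponent n 1
unitᵉ {suc n} zero    = 1 ∷ᵉ zeroᵉ n
unitᵉ {suc n} (suc i) = 0 ∷ᵉ unitᵉ i

-- The exponents of the products x_{i₁} ⋯ x_{i_d} with i₁ < ⋯ < i_d, each
-- listed once: the first variable is either skipped or used exactly once.

squarefree : ∀ n d → List (Exponent n d)
squarefree zero    zero    = zeroᵉ zero ∷ []
squarefree zero    (suc d) = []
squarefree (suc n) zero    = List.map (0 ∷ᵉ_) (squarefree n zero)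
squarefree (suc n) (suc d) =
  List.map (0 ∷ᵉ_) (squarefree n (suc d)) ++ List.map (1 ∷ᵉ_) (squarefree n d)

------------------------------------------------------------------------
-- Polynomials over a field

-- Inequality in the field is the tight apartness _#_. Classically every field
-- is a Heyting field in exactly one way, with x # y iff x ≉ y.

module Polynomials {c ℓ₁ ℓ₂ : Level} (K : HeytingField c ℓ₁ ℓ₂) where

  open HeytingField K

  private
    module R = CommutativeRing
      (HeytingCommutativeRing.commutativeRing heytingCommutativeRing)

  open RawMonoidDefs R.+-rawMonoid using (sum) renaming (_×_ to _·_)
  open RawMonoidDefs R.*-rawMonoid using () renaming (sum to product)
  open RawSemiringDefs (Semiring.rawSemiring R.semiring) using (_^_)

  -- No finite list exhausts the field, in positive form.

  Infinite : Set (c ⊔ ℓ₂)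
  Infinite = ∀ (xs : List Carrier) → ∃[ x ] All (x #_) xs

  HasCharacteristic : ℕ → Set ℓ₁
  HasCharacteristic p = ∀ m → (m · 1# ≈ 0#) ⇔ (p ∣ m)

  -- A homogeneous polynomial of degree d in n variables, given by its
  -- coefficients; there are only finitely many exponents.

  S : ℕ → ℕ → Set c
  S n d = Exponent n d → Carrier

  monomial : ∀ {n d} → Exponent n d → S n d
  monomial α β = if does (≡-dec ℕ._≟_ (proj₁ α) (proj₁ β)) then 1# else 0#

  supp : ∀ {n d} → S n d → Pred (Exponent n d) ℓ₂
  supp f α = f α # 0#

  e : ∀ n d → S n d
  e n d α = List.foldr _+_ 0# (List.map (λ β → monomial β α) (squarefree n d))

  infix 9 _[_]

  _[_] : ∀ {n} → S n 1 → ∀ d → S n d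
  (ℓ [ d ]) (α , _) = product λ i → ℓ (unitᵉ i) ^ lookup α i

  IsSumOfPowers : ∀ {n d} → S n d → ℕ → Set (c ⊔ ℓ₁)
  IsSumOfPowers {n} {d} f r =
    Σ (Fin r → S n 1) λ ℓ → ∀ α → f α ≈ sum (λ i → (ℓ i [ d ]) α)

  -- IsRν f r means Rν(f) = r.

  IsRν : ∀ {n d} → S n d → ℕ → Set (c ⊔ ℓ₁)
  IsRν f = IsMinimum (IsSumOfPowers f)

  Admissible : ∀ {n d} → S n d → Set ℓ₂
  Admissible {n} {d} g = supp g ≐ supp (e n d)

  -- IsA n d a means A(n,d) = a. Polynomials g with Rν(g) = ∞ do not contribute.

  IsA : ℕ → ℕ → ℕ → Set (c ⊔ ℓ₁ ⊔ ℓ₂)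
  IsA n d = IsMinimum λ r → Σ (S n d) λ g → Admissible g × IsRν g r

  -- A(n,d) ≤ m. That the minima in the definition of A(n,d) exist is only
  -- doubly negated, as they cannot be computed. The first component is the
  -- witness of the bound; classically the two components are equivalent.

  A≤ : ℕ → ℕ → ℕ → Set (c ⊔ ℓ₁ ⊔ ℓ₂)
  A≤ n d m =
    (Σ (S n d) λ g → Admissible g × (∃[ r ] r ≤ m × IsSumOfPowers g r)) ×
    ¬ ¬ (∃[ a ] IsA n d a × a ≤ m)

{-# OPTIONS --safe #-}

-- Take pairwise apart field elements x₁, …, xₙ and let g be the sum of
-- (∑ⱼ p(xⱼ) Xⱼ)^[d] over the 2ᵈ − 1 nonzero polynomials p of degree less than d
-- with coefficients in 𝔽₂. If y₁, …, y_d lists each xⱼ with multiplicity αⱼ,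
-- the coefficient of g at α is ∑ₚ p(y₁) ⋯ p(y_d). Such a sum over the 𝔽₂-span
-- of d functions is, by polarization, a permanent, hence in characteristic 2 a
-- determinant, and here it is the Vandermonde determinant ∏ (yⱼ + yᵢ). It
-- vanishes exactly when some y is repeated, i.e. when α is not squarefree.

module Submission where

open import Defs
open import Algebra.Apartness.Bundles using (HeytingField)
open import Data.Nat.Base using (ℕ; _≤_; _∸_; _^_)

open import Algebra.Apartness.Bundles using (HeytingCommutativeRing)
open import Algebra.Bundles using (CommutativeRing; Semiring)
open import Data.Bool.Base using (true; false; if_then_else_)
open import Data.Fin.Base using (Fin)
open import Data.List.Base as List using (List; []; _∷_; _++_; length; replicate)
open import Data.List.Properties using (++-assoc; length-++; length-replicate)
open import Data.List.Relation.Unary.All using (All; []; _∷_)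
open import Data.List.Relation.Unary.All.Properties using (++⁺; replicate⁺)
open import Data.Nat.Base as ℕ using (zero; suc; z≤n; s≤s)
open import Data.Nat.Divisibility using (∣-refl)
open import Data.Nat.Induction using (<-rec)
import Data.Nat.Properties as ℕ
open import Data.Product.Base using (Σ; ∃; ∃-syntax; _×_; _,_; proj₁; proj₂)
open import Data.Vec.Base as Vec using (Vec; []; _∷_; lookup)
open import Data.Vec.Properties using (≡-dec)
open import Data.Vec.Relation.Unary.All as VecAll using ([]; _∷_)
open import Data.Vec.Relation.Unary.All.Properties using (toList⁻)
open import Data.Vec.Relation.Unary.AllPairs using (AllPairs; []; _∷_)
open import Function.Base using (const; _∘_)
open import Function.Bundles using (Equivalence)
open import Relation.Binary.PropositionalEquality as ≡ using (_≡_)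
open import Relation.Nullary.Decidable using (yes; no; does)
open import Relation.Nullary.Negation using (¬_; contradiction)
open import Relation.Unary using (Pred)

-- Strong induction on `r`: if no minimum exists, the induction hypothesis excludes every `k` below
-- `r` from `P`, so `r` itself is a minimum, a contradiction. `P` is never decided, hence the double
-- negation.
¬¬-least : ∀ {p} (P : Pred ℕ p) r → P r → ¬ ¬ (∃[ m ] IsMinimum P m × m ≤ r)
¬¬-least P = <-rec _ λ r ih Pr none → none
  (r , (Pr , λ k Pk → ℕ.≮⇒≥ λ k<r → ih k<r Pk λ (m , least , m≤k) →
    none (m , least , ℕ.≤-trans m≤k (ℕ.<⇒≤ k<r))) , ℕ.≤-refl)

-- Span sums, permanents and Vandermonde products over a commutative ring

module Determinants {c ℓ} (R : CommutativeRing c ℓ) where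

  open CommutativeRing R hiding (zero)
  open import Algebra.Definitions.RawMonoid +-rawMonoid using (sum)
  open import Algebra.Solver.Ring.NaturalCoefficients.Default commutativeSemiring
    using (solve; _:=_; _:+_; _:*_)
  open import Relation.Binary.Reasoning.Setoid setoid

  Func : Set c
  Func = Carrier → Carrier

  infixl 6 _⊕_
  infixl 7 _⊗_

  _⊕_ _⊗_ : Func → Func → Func
  (f ⊕ g) x = f x + g x
  (f ⊗ g) x = f x * g x

  ∏ : List Carrier → Func → Carrier
  ∏ []      f = 1#
  ∏ (y ∷ w) f = f y * ∏ w f

  ∏-cong : ∀ {f g} → (∀ x → f x ≈ g x) → ∀ w → ∏ w f ≈ ∏ w g
  ∏-cong f≈g []      = refl
  ∏-cong f≈g (y ∷ w) = *-cong (f≈g y) (∏-cong f≈g w)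

  ∑ : ∀ {a} {A : Set a} → List A → (A → Carrier) → Carrier
  ∑ xs h = sum λ i → h (List.lookup xs i)

  ∑-++ : ∀ {a} {A : Set a} (h : A → Carrier) xs ys → ∑ (xs ++ ys) h ≈ ∑ xs h + ∑ ys h
  ∑-++ h []       ys = sym (+-identityˡ _)
  ∑-++ h (x ∷ xs) ys = trans (+-congˡ (∑-++ h xs ys)) (sym (+-assoc _ _ _))

  -- The functions summed over are `f` plus the sums of subsets of `vs`; coinciding ones count with
  -- multiplicity.
  spanSum : List Func → Func → List Carrier → Carrier
  spanSum []       f w = ∏ w f
  spanSum (v ∷ vs) f w = spanSum vs f w + spanSum vs (f ⊕ v) w

  -- The same functions without `f` itself, the one for the empty subset; this is where the bound
  -- loses 1 from the power of 2.
  properSpan : List Func → Func → List Func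
  properSpan []       f = []
  properSpan (v ∷ vs) f = properSpan vs f ++ f ⊕ v ∷ properSpan vs (f ⊕ v)

  length-properSpan : ∀ vs f → suc (length (properSpan vs f)) ≡ 2 ^ length vs
  length-properSpan []       f = ≡.refl
  length-properSpan (v ∷ vs) f
    rewrite length-++ (properSpan vs f) {f ⊕ v ∷ properSpan vs (f ⊕ v)}
          | length-properSpan vs (f ⊕ v)
          | ℕ.+-identityʳ (2 ^ length vs)
          = ≡.cong (ℕ._+ 2 ^ length vs) (length-properSpan vs f)

  spanSum-∑ : ∀ vs f w → spanSum vs f w ≈ ∏ w f + ∑ (properSpan vs f) (∏ w)
  spanSum-∑ []       f w = sym (+-identityʳ _)
  spanSum-∑ (v ∷ vs) f w = begin
    spanSum vs f w + spanSum vs (f ⊕ v) w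
      ≈⟨ +-cong (spanSum-∑ vs f w) (spanSum-∑ vs (f ⊕ v) w) ⟩
    (∏ w f + ∑ (properSpan vs f) (∏ w)) + ∑ (f ⊕ v ∷ properSpan vs (f ⊕ v)) (∏ w)
      ≈⟨ +-assoc _ _ _ ⟩
    ∏ w f + (∑ (properSpan vs f) (∏ w) + ∑ (f ⊕ v ∷ properSpan vs (f ⊕ v)) (∏ w))
      ≈⟨ +-congˡ (∑-++ (∏ w) (properSpan vs f) _) ⟨
    ∏ w f + ∑ (properSpan (v ∷ vs) f) (∏ w) ∎

  spanSum-cong : ∀ vs {f g} → (∀ x → f x ≈ g x) → ∀ w → spanSum vs f w ≈ spanSum vs g w
  spanSum-cong []       f≈g w = ∏-cong f≈g w
  spanSum-cong (v ∷ vs) f≈g w =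
    +-cong (spanSum-cong vs f≈g w) (spanSum-cong vs (λ x → +-congʳ (f≈g x)) w)

  spanSum-[] : ∀ vs f g → spanSum vs f [] ≈ spanSum vs g []
  spanSum-[] []       f g = refl
  spanSum-[] (v ∷ vs) f g = +-cong (spanSum-[] vs f g) (spanSum-[] vs (f ⊕ v) (g ⊕ v))

  -- Laplace expansion along a row, and the permanent

  laplace : (Func → List Func → Carrier) → List Func → Carrier
  laplace F []       = 0#
  laplace F (v ∷ vs) = F v vs + laplace (λ u us → F u (v ∷ us)) vs

  -- The hypothesis is given the length of the remaining list, so that arguments on lengths such as
  -- `det-short` can prove it.
  laplace-cong : ∀ vs {F G} → (∀ u us → suc (length us) ≡ length vs → F u us ≈ G u us) →
                 laplace F vs ≈ laplace G vs
  laplace-cong []       F≈G = refl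
  laplace-cong (v ∷ vs) F≈G =
    +-cong (F≈G v vs ≡.refl) (laplace-cong vs λ u us eq → F≈G u (v ∷ us) (≡.cong suc eq))

  laplace-zero : ∀ vs {F} → (∀ u us → suc (length us) ≡ length vs → F u us ≈ 0#) →
                 laplace F vs ≈ 0#
  laplace-zero []       F≈0 = refl
  laplace-zero (v ∷ vs) F≈0 = trans
    (+-cong (F≈0 v vs ≡.refl) (laplace-zero vs λ u us eq → F≈0 u (v ∷ us) (≡.cong suc eq)))
    (+-identityˡ 0#)

  laplace-+ : ∀ vs F G → laplace (λ u us → F u us + G u us) vs ≈ laplace F vs + laplace G vs
  laplace-+ []       F G = sym (+-identityˡ 0#)
  laplace-+ (v ∷ vs) F G = trans (+-congˡ (laplace-+ vs _ _))
    (solve 4 (λ a b x y → (a :+ b) :+ (x :+ y) := (a :+ x) :+ (b :+ y)) refl _ _ _ _)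

  laplace-* : ∀ k vs F → laplace (λ u us → k * F u us) vs ≈ k * laplace F vs
  laplace-* k []       F = sym (zeroʳ k)
  laplace-* k (v ∷ vs) F = trans (+-congˡ (laplace-* k vs _)) (sym (distribˡ k _ _))

  laplace-++ : ∀ F us vs → laplace F (us ++ vs) ≈
               laplace (λ a as → F a (as ++ vs)) us + laplace (λ a as → F a (us ++ as)) vs
  laplace-++ F []       vs = sym (+-identityˡ _)
  laplace-++ F (u ∷ us) vs = trans (+-congˡ (laplace-++ _ us vs)) (sym (+-assoc _ _ _))

  laplace-map : ∀ F (g : Func → Func) vs →
                laplace F (List.map g vs) ≈ laplace (λ u us → F (g u) (List.map g us)) vs
  laplace-map F g []       = refl
  laplace-map F g (v ∷ vs) = +-congˡ (laplace-map _ g vs)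

  -- In the product for `f` plus the sum of a subset, the factor at `y` splits into `f y` and one
  -- `v y` for each `v` in the subset. For fixed `v`, the subsets containing it give a span sum over
  -- the other functions with offset `f ⊕ v`.
  spanSum-∷ : ∀ vs f y w → spanSum vs f (y ∷ w) ≈
              f y * spanSum vs f w + laplace (λ v us → v y * spanSum us (f ⊕ v) w) vs
  spanSum-∷ []       f y w = sym (+-identityʳ _)
  spanSum-∷ (v ∷ vs) f y w = begin
    spanSum vs f (y ∷ w) + spanSum vs (f ⊕ v) (y ∷ w)
      ≈⟨ +-cong (spanSum-∷ vs f y w) (spanSum-∷ vs (f ⊕ v) y w) ⟩
    (f y * spanSum vs f w + laplace F vs) +
    ((f y + v y) * spanSum vs (f ⊕ v) w + laplace (λ u us → u y * spanSum us (f ⊕ v ⊕ u) w) vs)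
      ≈⟨ +-congˡ (+-congˡ (laplace-cong vs λ u us _ → *-congˡ (spanSum-cong us
           (λ x → solve 3 (λ a b c → (a :+ b) :+ c := (a :+ c) :+ b) refl _ _ _) w))) ⟩
    (f y * spanSum vs f w + laplace F vs) +
    ((f y + v y) * spanSum vs (f ⊕ v) w + laplace G vs)
      ≈⟨ solve 6 (λ a b A B L M → (a :* A :+ L) :+ ((a :+ b) :* B :+ M) :=
                   a :* (A :+ B) :+ (b :* B :+ (L :+ M))) refl _ _ _ _ _ _ ⟩
    f y * spanSum (v ∷ vs) f w + (v y * spanSum vs (f ⊕ v) w + (laplace F vs + laplace G vs))
      ≈⟨ +-congˡ (+-congˡ (laplace-+ vs F G)) ⟨
    f y * spanSum (v ∷ vs) f w +
    (v y * spanSum vs (f ⊕ v) w + laplace (λ u us → F u us + G u us) vs)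
      ≈⟨ +-congˡ (+-congˡ (laplace-cong vs λ u us _ → distribˡ (u y) _ _)) ⟨
    f y * spanSum (v ∷ vs) f w +
    laplace (λ u us → u y * spanSum us (f ⊕ u) w) (v ∷ vs) ∎
    where
    F G : Func → List Func → Carrier
    F u us = u y * spanSum us (f ⊕ u) w
    G u us = u y * spanSum us (f ⊕ u ⊕ v) w

  -- Signs are omitted, so this is the permanent of (v y) for v in vs and y in w.
  -- It is 0# when the two lists have different lengths.

  det : List Func → List Carrier → Carrier
  det vs []      = if List.null vs then 1# else 0#
  det vs (y ∷ w) = laplace (λ v us → v y * det us w) vs

  det-assoc : ∀ us u w vs → det ((us ++ u ∷ []) ++ vs) w ≡ det (us ++ u ∷ vs) w
  det-assoc us u w vs = ≡.cong (λ as → det as w) (++-assoc us (u ∷ []) vs)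

  -- Each point of `w` uses up one function, so some function is left when the points run out and
  -- the default `0#` is reached.
  det-short : ∀ vs w → length w ℕ.< length vs → det vs w ≈ 0#
  det-short (v ∷ vs) []      _   = refl
  det-short vs       (y ∷ w) w<v = laplace-zero vs λ u us eq → trans
    (*-congˡ (det-short us w (ℕ.s≤s⁻¹ (≡.subst (suc (suc (length w)) ≤_) (≡.sym eq) w<v))))
    (zeroʳ (u y))

  -- Splitting the expansion at the changed column gives its own entry, whose minor is unaffected,
  -- and two sums of smaller minors, where induction applies.
  det-linear : ∀ us {t u v k vs} → (∀ x → t x ≈ u x + k * v x) → ∀ w →
               det (us ++ t ∷ vs) w ≈ det (us ++ u ∷ vs) w + k * det (us ++ v ∷ vs) w
  det-linear []      {k = k} t≈u+kv [] = sym (trans (+-identityˡ _) (zeroʳ k))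
  det-linear (_ ∷ _) {k = k} t≈u+kv [] = sym (trans (+-identityˡ _) (zeroʳ k))
  det-linear us {t} {u} {v} {k} {vs} t≈u+kv (y ∷ w) = begin
    det (us ++ t ∷ vs) (y ∷ w)
      ≈⟨ laplace-++ _ us (t ∷ vs) ⟩
    laplace (F t) us + (t y * m + laplace (G t) vs)
      ≈⟨ +-cong
           (linear us λ a as → det-linear as t≈u+kv w)
           (+-cong (*-congʳ (t≈u+kv y))
             (linear vs λ a as → det-linear us t≈u+kv w)) ⟩
    (laplace (F u) us + k * laplace (F v) us) +
    ((u y + k * v y) * m + (laplace (G u) vs + k * laplace (G v) vs))
      ≈⟨ solve 8 (λ a b c d e f p m →
           (a :+ p :* b) :+ ((c :+ p :* d) :* m :+ (e :+ p :* f)) :=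
           (a :+ (c :* m :+ e)) :+ p :* (b :+ (d :* m :+ f))) refl _ _ _ _ _ _ _ _ ⟩
    (laplace (F u) us + (u y * m + laplace (G u) vs)) +
    k * (laplace (F v) us + (v y * m + laplace (G v) vs))
      ≈⟨ +-cong (laplace-++ _ us (u ∷ vs)) (*-congˡ (laplace-++ _ us (v ∷ vs))) ⟨
    det (us ++ u ∷ vs) (y ∷ w) + k * det (us ++ v ∷ vs) (y ∷ w) ∎
    where
    m = det (us ++ vs) w
    F G : Func → Func → List Func → Carrier
    F b a as = a y * det (as ++ b ∷ vs) w
    G b a as = a y * det (us ++ b ∷ as) w

    linear : ∀ bs {A B C : Func → List Func → Carrier} →
             (∀ a as → A a as ≈ B a as + k * C a as) →
             laplace (λ a as → a y * A a as) bs ≈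
             laplace (λ a as → a y * B a as) bs + k * laplace (λ a as → a y * C a as) bs
    linear bs {A} {B} {C} A≈B+kC = begin
      laplace (λ a as → a y * A a as) bs
        ≈⟨ laplace-cong bs (λ a as _ → trans (*-congˡ (A≈B+kC a as))
             (solve 4 (λ a b k c → a :* (b :+ k :* c) := a :* b :+ k :* (a :* c)) refl _ _ _ _)) ⟩
      laplace (λ a as → a y * B a as + k * (a y * C a as)) bs
        ≈⟨ laplace-+ bs _ _ ⟩
      laplace (λ a as → a y * B a as) bs + laplace (λ a as → k * (a y * C a as)) bs
        ≈⟨ +-congˡ (laplace-* k bs _) ⟩
      laplace (λ a as → a y * B a as) bs + k * laplace (λ a as → a y * C a as) bs ∎

  -- Row `y` acquires the common factor `m y`.
  det-scale : ∀ m vs w → det (List.map (m ⊗_) vs) w ≈ ∏ w m * det vs w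
  det-scale m []       []      = sym (*-identityˡ 1#)
  det-scale m (v ∷ vs) []      = sym (zeroʳ 1#)
  det-scale m vs       (y ∷ w) = begin
    det (List.map (m ⊗_) vs) (y ∷ w)
      ≈⟨ laplace-map _ (m ⊗_) vs ⟩
    laplace (λ u us → m y * u y * det (List.map (m ⊗_) us) w) vs
      ≈⟨ laplace-cong vs (λ u us _ → trans (*-congˡ (det-scale m us w))
           (solve 4 (λ a b p d → (a :* b) :* (p :* d) := (a :* p) :* (b :* d)) refl _ _ _ _)) ⟩
    laplace (λ u us → m y * ∏ w m * (u y * det us w)) vs
      ≈⟨ laplace-* _ vs _ ⟩
    ∏ (y ∷ w) m * det vs (y ∷ w) ∎

  -- Powers and the Vandermonde product

  powers : Func → ℕ → List Func
  powers u zero    = []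
  powers u (suc k) = u ∷ powers (λ x → x * u x) k

  length-powers : ∀ u k → length (powers u k) ≡ k
  length-powers u zero    = ≡.refl
  length-powers u (suc k) = ≡.cong suc (length-powers _ k)

  -- The product of all `yⱼ + yᵢ` with i < j, which in characteristic 2 is the usual product of
  -- differences.
  vandermonde : List Carrier → Carrier
  vandermonde []      = 1#
  vandermonde (y ∷ w) = ∏ w (_+ y) * vandermonde w

  -- Determinant calculus in characteristic 2

  module CharacteristicTwo (x+x≈0 : ∀ x → x + x ≈ 0#) where

    -- In `spanSum-∷` the term with `f y` carries a span sum over fewer points than functions, which
    -- by induction is a permanent with too few rows and vanishes. The rest is the Laplace
    -- expansion, so the offset `f` drops out.
    spanSum≈det : ∀ vs f w → length w ≤ length vs → spanSum vs f w ≈ det vs w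
    spanSum≈det []       f []      _   = refl
    -- With no points left all subsets contribute the same, so the two halves cancel.
    spanSum≈det (v ∷ vs) f []      _   = trans (+-congˡ (spanSum-[] vs (f ⊕ v) f)) (x+x≈0 _)
    spanSum≈det vs       f (y ∷ w) w<v = begin
      spanSum vs f (y ∷ w)
        ≈⟨ spanSum-∷ vs f y w ⟩
      f y * spanSum vs f w + laplace (λ v us → v y * spanSum us (f ⊕ v) w) vs
        ≈⟨ +-cong
             (trans (*-congˡ (trans (spanSum≈det vs f w (ℕ.<⇒≤ w<v)) (det-short vs w w<v)))
               (zeroʳ (f y)))
             (laplace-cong vs λ u us eq → *-congˡ (spanSum≈det us (f ⊕ u) w
               (ℕ.s≤s⁻¹ (≡.subst (suc (length w) ≤_) (≡.sym eq) w<v)))) ⟩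
      0# + det vs (y ∷ w)
        ≈⟨ +-identityˡ _ ⟩
      det vs (y ∷ w) ∎

    -- Choosing either copy of `u` leaves the same minor, so these two terms cancel; every other
    -- minor still contains both copies.
    det-repeat : ∀ us u vs w → det (us ++ u ∷ u ∷ vs) w ≈ 0#
    det-repeat []      u vs [] = refl
    det-repeat (_ ∷ _) u vs [] = refl
    det-repeat us u vs (y ∷ w) = begin
      det (us ++ u ∷ u ∷ vs) (y ∷ w)
        ≈⟨ laplace-++ _ us (u ∷ u ∷ vs) ⟩
      laplace (λ a as → a y * det (as ++ u ∷ u ∷ vs) w) us + (m + (m +
        laplace (λ a as → a y * det (us ++ u ∷ u ∷ as) w) vs))
        ≈⟨ +-cong
             (laplace-zero us λ a as _ → trans (*-congˡ (det-repeat as u vs w)) (zeroʳ (a y)))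
             (+-congˡ (+-congˡ (laplace-zero vs λ a as _ →
               trans (*-congˡ (det-repeat us u as w)) (zeroʳ (a y))))) ⟩
      0# + (m + (m + 0#))
        ≈⟨ +-identityˡ _ ⟩
      m + (m + 0#)
        ≈⟨ +-congˡ (+-identityʳ m) ⟩
      m + m
        ≈⟨ x+x≈0 m ⟩
      0# ∎
      where m = u y * det (us ++ u ∷ vs) w

    -- By linearity the extra term is `k` times a determinant with `u` repeated.
    det-columnOperation : ∀ us u {t v k vs} → (∀ x → t x ≈ v x + k * u x) → ∀ w →
                          det (us ++ u ∷ t ∷ vs) w ≈ det (us ++ u ∷ v ∷ vs) w
    det-columnOperation us u {t} {v} {k} {vs} t≈v+ku w = begin
      det (us ++ u ∷ t ∷ vs) w
        ≡⟨ det-assoc us u w (t ∷ vs) ⟨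
      det ((us ++ u ∷ []) ++ t ∷ vs) w
        ≈⟨ det-linear (us ++ u ∷ []) t≈v+ku w ⟩
      det ((us ++ u ∷ []) ++ v ∷ vs) w + k * det ((us ++ u ∷ []) ++ u ∷ vs) w
        ≡⟨ ≡.cong₂ (λ a b → a + k * b) (det-assoc us u w (v ∷ vs)) (det-assoc us u w (u ∷ vs)) ⟩
      det (us ++ u ∷ v ∷ vs) w + k * det (us ++ u ∷ u ∷ vs) w
        ≈⟨ +-congˡ (trans (*-congˡ (det-repeat us u vs w)) (zeroʳ k)) ⟩
      det (us ++ u ∷ v ∷ vs) w + 0#
        ≈⟨ +-identityʳ _ ⟩
      det (us ++ u ∷ v ∷ vs) w ∎

    -- Each column after the first trades `x` times its predecessor for `x + k` times it. The last
    -- column is treated first, so every predecessor is still unmodified when it is used.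
    det-powers : ∀ k n us u w → det (us ++ powers u (suc n)) w ≈
                 det (us ++ u ∷ List.map ((_+ k) ⊗_) (powers u n)) w
    det-powers k zero    us u w = refl
    det-powers k (suc n) us u w = begin
      det (us ++ u ∷ powers xu (suc n)) w
        ≡⟨ det-assoc us u w (powers xu (suc n)) ⟨
      det ((us ++ u ∷ []) ++ powers xu (suc n)) w
        ≈⟨ det-powers k n (us ++ u ∷ []) xu w ⟩
      det ((us ++ u ∷ []) ++ xu ∷ List.map ((_+ k) ⊗_) (powers xu n)) w
        ≡⟨ det-assoc us u w (xu ∷ _) ⟩
      det (us ++ u ∷ xu ∷ List.map ((_+ k) ⊗_) (powers xu n)) w
        ≈⟨ det-columnOperation us u (λ x → distribʳ (u x) x k) w ⟨
      det (us ++ u ∷ List.map ((_+ k) ⊗_) (powers u (suc n))) w ∎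
      where
      xu : Func
      xu x = x * u x

    det-vandermonde : ∀ w → det (powers (const 1#) (length w)) w ≈ vandermonde w
    det-vandermonde []      = refl
    det-vandermonde (y ∷ w) = begin
      det (powers (const 1#) (suc (length w))) (y ∷ w)
        -- With `k = y` the factor `x + y` vanishes at `y`, so the row of `y` becomes 1 followed by
        -- zeros.
        ≈⟨ det-powers y (length w) [] (const 1#) (y ∷ w) ⟩
      det (const 1# ∷ List.map ((_+ y) ⊗_) vs) (y ∷ w)
        ≈⟨ +-cong (*-identityˡ _) (trans (laplace-map _ ((_+ y) ⊗_) vs)
             (laplace-zero vs λ u us _ → vanish u us)) ⟩
      det (List.map ((_+ y) ⊗_) vs) w + 0#
        ≈⟨ +-identityʳ _ ⟩
      det (List.map ((_+ y) ⊗_) vs) w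
        ≈⟨ det-scale (_+ y) vs w ⟩
      ∏ w (_+ y) * det vs w
        ≈⟨ *-congˡ (det-vandermonde w) ⟩
      vandermonde (y ∷ w) ∎
      where
      vs = powers (const 1#) (length w)
      vanish : ∀ u us → (y + y) * u y * det (const 1# ∷ List.map ((_+ y) ⊗_) us) w ≈ 0#
      vanish u us = trans
        (*-congʳ (trans (*-congʳ (x+x≈0 y)) (zeroˡ (u y)))) (zeroˡ _)

    ∑-properSpan : ∀ d w → length w ≡ suc d →
                   ∑ (properSpan (powers (const 1#) (suc d)) (const 0#)) (∏ w) ≈ vandermonde w
    ∑-properSpan d w@(y ∷ w′) ≡.refl = begin
      ∑ (properSpan vs (const 0#)) (∏ w)
        ≈⟨ +-identityˡ _ ⟨
      0# + ∑ (properSpan vs (const 0#)) (∏ w)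
        -- As `w` is nonempty, the zero function contributes nothing and can be put back to complete
        -- the span.
        ≈⟨ +-congʳ (zeroˡ _) ⟨
      ∏ w (const 0#) + ∑ (properSpan vs (const 0#)) (∏ w)
        ≈⟨ spanSum-∑ vs (const 0#) w ⟨
      spanSum vs (const 0#) w
        ≈⟨ spanSum≈det vs (const 0#) w (ℕ.≤-reflexive (≡.sym (length-powers _ (suc d)))) ⟩
      det vs w
        ≈⟨ det-vandermonde w ⟩
      vandermonde w ∎
      where vs = powers (const 1#) (suc d)

    vandermonde-repeat : ∀ y w → vandermonde (y ∷ y ∷ w) ≈ 0#
    vandermonde-repeat y w =
      trans (*-congʳ (trans (*-congʳ (x+x≈0 y)) (zeroˡ _))) (zeroˡ _)

-- Words with prescribed multiplicities

word : ∀ {a} {A : Set a} {n} → Vec A n → Vec ℕ n → List A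
word []       []      = []
word (x ∷ xs) (a ∷ α) = replicate a x ++ word xs α

length-word : ∀ {a} {A : Set a} {n} (xs : Vec A n) α → length (word xs α) ≡ Vec.sum α
length-word []       []      = ≡.refl
length-word (x ∷ xs) (a ∷ α)
  rewrite length-++ (replicate a x) {word xs α} | length-replicate a {x} =
  ≡.cong (a ℕ.+_) (length-word xs α)

All-word : ∀ {a p} {A : Set a} {P : Pred A p} {n} {xs : Vec A n} →
           VecAll.All P xs → ∀ α → All P (word xs α)
All-word []         []      = []
All-word (px ∷ pxs) (a ∷ α) = ++⁺ (replicate⁺ a px) (All-word pxs α)

Squarefree : ∀ {n} → Pred (Vec ℕ n) _
Squarefree = VecAll.All (_≤ 1)

-- Construction over a field, starting with the coefficients of `e`

module Witness {c ℓ₁ ℓ₂} (K : HeytingField c ℓ₁ ℓ₂) where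

  open Polynomials K
  open HeytingField K using (_#_; #-irrefl; #⇒invertible; heytingCommutativeRing)
  open import Algebra.Apartness.Properties.HeytingCommutativeRing heytingCommutativeRing
    using (1#0; x#0y#0→xy#0; #-congʳ; x-0≈x; invertibleˡ⇒#)
  open HeytingCommutativeRing heytingCommutativeRing using (commutativeRing)
  open CommutativeRing commutativeRing hiding (zero)
  open Determinants commutativeRing
  open import Algebra.Definitions.RawSemiring (Semiring.rawSemiring semiring)
    using (product; sum) renaming (_^_ to _^ᴷ_)
  open import Algebra.Properties.Monoid.Sum +-monoid using (sum-cong-≋)
  open import Algebra.Properties.Ring ring using (+-cancelˡ)
  open import Relation.Binary.Reasoning.Setoid setoid

  -- For the list `squarefree n d` this is the coefficient of `e n d`. Taking a bare vector instead
  -- of an `Exponent` allows recursion on its entries with no proof of the degree.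
  sumAt : ∀ {n d} → List (Exponent n d) → Vec ℕ n → Carrier
  sumAt βs α = List.foldr _+_ 0#
    (List.map (λ β → if does (≡-dec ℕ._≟_ (proj₁ β) α) then 1# else 0#) βs)

  sumAt-++ : ∀ {n d} (βs γs : List (Exponent n d)) α →
             sumAt (βs ++ γs) α ≈ sumAt βs α + sumAt γs α
  sumAt-++ []       γs α = sym (+-identityˡ _)
  sumAt-++ (β ∷ βs) γs α = trans (+-congˡ (sumAt-++ βs γs α)) (sym (+-assoc _ _ _))

  -- The hypothesis is about `≡ᵇ`, to which the decision for the first entries computes, so
  -- rewriting by it leaves only the comparison of the tails.
  sumAt-match : ∀ {n d a b} → (b ℕ.≡ᵇ a) ≡ true → ∀ (βs : List (Exponent n d)) α →
                sumAt (List.map (b ∷ᵉ_) βs) (a ∷ α) ≈ sumAt βs α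
  sumAt-match b≡a []       α = refl
  sumAt-match b≡a (β ∷ βs) α rewrite b≡a = +-congˡ (sumAt-match b≡a βs α)

  sumAt-mismatch : ∀ {n d a b} → (b ℕ.≡ᵇ a) ≡ false → ∀ (βs : List (Exponent n d)) α →
                   sumAt (List.map (b ∷ᵉ_) βs) (a ∷ α) ≈ 0#
  sumAt-mismatch b≢a []       α = refl
  sumAt-mismatch b≢a (β ∷ βs) α rewrite b≢a =
    trans (+-identityˡ _) (sumAt-mismatch b≢a βs α)

  sumAt-split : ∀ {n} d α → sumAt (squarefree (suc n) (suc d)) α ≈
                sumAt (List.map (0 ∷ᵉ_) (squarefree n (suc d))) α +
                sumAt (List.map (1 ∷ᵉ_) (squarefree n d)) α
  sumAt-split {n} d α = sumAt-++ (List.map (0 ∷ᵉ_) (squarefree n (suc d))) _ α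

  -- At each entry only one half of `sumAt-split` can match, so `α` is met exactly once; an even
  -- multiplicity would vanish in characteristic 2.
  sumAt-squarefree : ∀ {n} d {α : Vec ℕ n} → Squarefree α → Vec.sum α ≡ d →
                     sumAt (squarefree n d) α ≈ 1#
  sumAt-squarefree zero    []                         eq = +-identityʳ 1#
  sumAt-squarefree zero    {_ ∷ α} (z≤n ∷ sf)         eq =
    trans (sumAt-match ≡.refl (squarefree _ zero) α) (sumAt-squarefree zero sf eq)
  sumAt-squarefree (suc d) {_ ∷ α} (z≤n ∷ sf)         eq = trans (sumAt-split d (0 ∷ α)) (trans
    (+-cong (trans (sumAt-match ≡.refl (squarefree _ (suc d)) α)
              (sumAt-squarefree (suc d) sf eq))
            (sumAt-mismatch ≡.refl (squarefree _ d) α))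
    (+-identityʳ 1#))
  sumAt-squarefree (suc d) {_ ∷ α} (s≤s z≤n ∷ sf)     eq = trans (sumAt-split d (1 ∷ α)) (trans
    (+-cong (sumAt-mismatch ≡.refl (squarefree _ (suc d)) α)
            (trans (sumAt-match ≡.refl (squarefree _ d) α)
              (sumAt-squarefree d sf (≡.cong ℕ.pred eq))))
    (+-identityˡ 1#))

  sumAt-¬squarefree : ∀ {n} d {α : Vec ℕ n} → ¬ Squarefree α → sumAt (squarefree n d) α ≈ 0#
  sumAt-¬squarefree d       {[]}              ¬sf = contradiction [] ¬sf
  sumAt-¬squarefree zero    {zero ∷ α}        ¬sf =
    trans (sumAt-match ≡.refl (squarefree _ zero) α) (sumAt-¬squarefree zero (¬sf ∘ (z≤n ∷_)))
  sumAt-¬squarefree zero    {suc a ∷ α}       ¬sf =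
    sumAt-mismatch ≡.refl (squarefree _ zero) α
  sumAt-¬squarefree (suc d) {a ∷ α}           ¬sf =
    trans (sumAt-split d (a ∷ α)) (trans (+-cong (skipped a ¬sf) (used a ¬sf)) (+-identityʳ 0#))
    where
    skipped : ∀ a → ¬ Squarefree (a ∷ α) →
              sumAt (List.map (0 ∷ᵉ_) (squarefree _ (suc d))) (a ∷ α) ≈ 0#
    skipped zero    ¬sf = trans (sumAt-match ≡.refl (squarefree _ (suc d)) α)
                                (sumAt-¬squarefree (suc d) (¬sf ∘ (z≤n ∷_)))
    skipped (suc a) ¬sf = sumAt-mismatch ≡.refl (squarefree _ (suc d)) α
    used : ∀ a → ¬ Squarefree (a ∷ α) →
           sumAt (List.map (1 ∷ᵉ_) (squarefree _ d)) (a ∷ α) ≈ 0#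
    used zero          ¬sf = sumAt-mismatch ≡.refl (squarefree _ d) α
    used (suc zero)    ¬sf = trans (sumAt-match ≡.refl (squarefree _ d) α)
                                   (sumAt-¬squarefree d (¬sf ∘ (s≤s z≤n ∷_)))
    used (suc (suc a)) ¬sf = sumAt-mismatch ≡.refl (squarefree _ d) α

  -- Apart elements and powers of linear forms

  apartElements : Infinite → ∀ n → ∃ λ (xs : Vec Carrier n) → AllPairs _#_ xs
  apartElements inf zero    = [] , []
  apartElements inf (suc n) with apartElements inf n
  ... | xs , xs# with inf (Vec.toList xs)
  ...   | x , x# = x ∷ xs , toList⁻ x# ∷ xs#

  -- The linear form ∑ⱼ p(xⱼ) Xⱼ, where β = unitᵉ j is decoded by its first nonzero entry.

  linearForm : ∀ {n} → Vec Carrier n → Func → S n 1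
  linearForm xs p (β , _) = go xs β
    where
    go : ∀ {n} → Vec Carrier n → Vec ℕ n → Carrier
    go []       []          = 0#
    go (x ∷ xs) (zero  ∷ β) = go xs β
    go (x ∷ xs) (suc _ ∷ β) = p x

  ∏-replicate-++ : ∀ p x a w → p x ^ᴷ a * ∏ w p ≈ ∏ (replicate a x ++ w) p
  ∏-replicate-++ p x zero    w = *-identityˡ _
  ∏-replicate-++ p x (suc a) w = trans (*-assoc _ _ _) (*-congˡ (∏-replicate-++ p x a w))

  product-linearForm : ∀ {n} (xs : Vec Carrier n) p α →
    product (λ i → linearForm xs p (unitᵉ i) ^ᴷ lookup α i) ≈ ∏ (word xs α) p
  product-linearForm []       p []      = refl
  product-linearForm (x ∷ xs) p (a ∷ α) =
    trans (*-congˡ (product-linearForm xs p α)) (∏-replicate-++ p x a (word xs α))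

  -- The witness in characteristic 2

  module _ (inf : Infinite) (char2 : HasCharacteristic 2) where

    x+x≈0 : ∀ x → x + x ≈ 0#
    x+x≈0 x = begin
      x + x                ≈⟨ +-cong (*-identityʳ x) (*-identityʳ x) ⟨
      x * 1# + x * 1#      ≈⟨ distribˡ x 1# 1# ⟨
      -- The trailing `0#` brings the factor into the unfolded form of `2 · 1#`.
      x * (1# + 1#)        ≈⟨ *-congˡ (+-congˡ (+-identityʳ 1#)) ⟨
      x * (1# + (1# + 0#)) ≈⟨ *-congˡ (Equivalence.from (char2 2) ∣-refl) ⟩
      x * 0#               ≈⟨ zeroʳ x ⟩
      0#                   ∎

    open CharacteristicTwo x+x≈0

    -- Apartness amounts to invertibility of the difference, and here negation is the identity.
    #⇒+#0 : ∀ {x y} → x # y → y + x # 0#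
    #⇒+#0 {x} {y} x#y with #⇒invertible x#y
    ... | z , z*[x-y]≈1 , _ = #-congʳ x-y≈y+x
      -- Apartness of `x - y` from `0#` asks for an inverse of `(x - y) - 0#`, hence `x-0≈x`.
      (invertibleˡ⇒# (z , trans (*-congˡ (x-0≈x (x - y))) z*[x-y]≈1))
      where
      x-y≈y+x : x - y ≈ y + x
      x-y≈y+x = trans
        (+-congˡ (+-cancelˡ y _ _ (trans (-‿inverseʳ y) (sym (x+x≈0 y)))))
        (+-comm x y)

    -- A squarefree word contains each of the apart elements at most once, so every factor is apart
    -- from `0#`, and such elements are closed under products.
    vandermonde-word# : ∀ {n} {xs : Vec Carrier n} → AllPairs _#_ xs →
                        ∀ {α} → Squarefree α → vandermonde (word xs α) # 0#
    vandermonde-word# []         []               = 1#0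
    vandermonde-word# (_ ∷ xs#)  (z≤n ∷ sf)       = vandermonde-word# xs# sf
    vandermonde-word# (x# ∷ xs#) {_ ∷ α} (s≤s z≤n ∷ sf) =
      x#0y#0→xy#0 (∏# (All-word x# α)) (vandermonde-word# xs# sf)
      where
      ∏# : ∀ {y w} → All (y #_) w → ∏ w (_+ y) # 0#
      ∏# []         = 1#0
      ∏# (y#z ∷ y#) = x#0y#0→xy#0 (#⇒+#0 y#z) (∏# y#)

    -- Equal letters stand side by side in `word`, so `vandermonde-repeat` applies at the first
    -- entry of at least 2; the factors in front of it only multiply zero.
    vandermonde-word≈0 : ∀ {n} (xs : Vec Carrier n) {α} → ¬ Squarefree α →
                         vandermonde (word xs α) ≈ 0#
    vandermonde-word≈0 []       {[]}              ¬sf = contradiction [] ¬sf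
    vandermonde-word≈0 (x ∷ xs) {zero ∷ α}        ¬sf =
      vandermonde-word≈0 xs (¬sf ∘ (z≤n ∷_))
    vandermonde-word≈0 (x ∷ xs) {suc zero ∷ α}    ¬sf =
      trans (*-congˡ (vandermonde-word≈0 xs (¬sf ∘ (s≤s z≤n ∷_)))) (zeroʳ _)
    vandermonde-word≈0 (x ∷ xs) {suc (suc a) ∷ α} ¬sf =
      vandermonde-repeat x (replicate a x ++ word xs α)

    -- The degree is written `suc d` because `∑-properSpan` works with nonempty words.
    witness : ∀ n d → Σ (S n (suc d)) λ g →
              Admissible g × ∃[ r ] r ≤ 2 ^ suc d ∸ 1 × IsSumOfPowers g r
    witness n d =
      g , ((λ {α} → ⊆ {α}) , (λ {α} → ⊇ {α})) ,
      -- `g` is by definition the sum of the powers, so the decomposition holds by `refl`.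
      length ps , ℕ.≤-reflexive length-ps , ℓ , λ _ → refl
      where
      xs  = proj₁ (apartElements inf n)
      xs# = proj₂ (apartElements inf n)

      ps : List Func
      ps = properSpan (powers (const 1#) (suc d)) (const 0#)

      length-ps : length ps ≡ 2 ^ suc d ∸ 1
      length-ps = ≡.cong (_∸ 1) (≡.trans
        (length-properSpan (powers (const 1#) (suc d)) (const 0#))
        (≡.cong (2 ^_) (length-powers _ (suc d))))

      ℓ : Fin (length ps) → S n 1
      ℓ i = linearForm xs (List.lookup ps i)

      g : S n (suc d)
      g α = sum λ i → (ℓ i [ suc d ]) α

      g≈vandermonde : ∀ α → g α ≈ vandermonde (word xs (proj₁ α))
      g≈vandermonde (α , |α|) = trans
        (sum-cong-≋ λ i → product-linearForm xs (List.lookup ps i) α)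
        (∑-properSpan d (word xs α) (≡.trans (length-word xs α) |α|))

      ⊆ : ∀ {α} → g α # 0# → e n (suc d) α # 0#
      ⊆ {α , |α|} gα# with VecAll.all? (ℕ._≤? 1) α
      ... | yes sf = #-congʳ (sym (sumAt-squarefree (suc d) sf |α|)) 1#0
      ... | no ¬sf = contradiction gα#
        (#-irrefl (trans (g≈vandermonde (α , |α|)) (vandermonde-word≈0 xs ¬sf)))

      ⊇ : ∀ {α} → e n (suc d) α # 0# → g α # 0#
      ⊇ {α , |α|} eα# with VecAll.all? (ℕ._≤? 1) α
      ... | yes sf = #-congʳ (sym (g≈vandermonde (α , |α|))) (vandermonde-word# xs# sf)
      ... | no ¬sf = contradiction eα# (#-irrefl (sumAt-¬squarefree (suc d) ¬sf))

theorem52 : ∀ {c ℓ₁ ℓ₂} (K : HeytingField c ℓ₁ ℓ₂) → let open Polynomials K in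
    Infinite → HasCharacteristic 2 →
    ∀ (n d : ℕ) → 1 ≤ d → A≤ n d (2 ^ d ∸ 1)
theorem52 K inf char2 n (suc d) _ with Witness.witness K inf char2 n d
... | w@(g , adm , r , r≤m , powers) = w , λ none →
  -- Two minima are nested: first the rank `r′` of `g`, at most `r`, which shows that the set of
  -- ranks of admissible polynomials is inhabited; then the minimum `a` of that set, at most `r′`.
  ¬¬-least (IsSumOfPowers g) r powers λ (r′ , rank , r′≤r) →
  ¬¬-least _ r′ (g , adm , rank) λ (a , isA , a≤r′) →
  none (a , isA , ℕ.≤-trans a≤r′ (ℕ.≤-trans r′≤r r≤m))
  where open Polynomials K
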